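{- Let $p$ be a prime number. Then $$|\nu_{p^k,Z(\mathbb{Z}_{p^k})}| = |\nu_{p^{k-1}}| - k +1$$ for every integer $k\geq 2$. In the case $k=1$, $|\nu_{p,Z(\mathbb{Z}_{p})}| = 0$.
   Context: For a positive integer $n$, elements of $\mathbb{Z}_n$ are identified with their representatives $0,1,\dots,n-1$. An unordered pair $\{a,b\}$ with $0\le a,b<n$ ($a=b$ allowed) is called a gcd-pair in $\mathbb{Z}_n$ if $\gcd(a,b)$ divides $n$. Here $\gcd(0,a)=a$ and $\gcd(0,0)=0$, so $\{0,0\}$ is not a gcd-pair. $\nu_n$ denotes the set of all gcd-pairs in $\mathbb{Z}_n$, and for $A\subseteq\mathbb{Z}_n$, $\nu_{n,A}$ denotes the set of those gcd-pairs $\{a,b\}\in\nu_n$ with $a,b\in A$. $Z(\mathbb{Z}_n)$ denotes the set of zero divisors of $\mathbb{Z}_n$, where the zero element is not counted as a zero divisor. -}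

module Defs where

open import Data.Fin.Base using (Fin; toℕ)
open import Data.Fin.Properties using (any?; nonZeroIndex) renaming (_≤?_ to _≤ᶠ?_)
open import Data.Fin.Subset using (Subset)
open import Data.Fin.Subset.Properties using (_∈?_)
open import Data.List.Base using (List; allFin; cartesianProduct; filter)
open import Data.Nat.Base using (ℕ; _*_)
open import Data.Nat.DivMod using (_mod_)
open import Data.Nat.Divisibility using (_∣_; _∣?_)
open import Data.Nat.GCD using (gcd)
open import Data.Nat.Properties using (_≟_)
open import Data.Product.Base using (∃-syntax; _×_; _,_)
open import Data.Vec.Base using (tabulate)
open import Relation.Binary.PropositionalEquality.Core using (_≢_; _≡_)
open import Relation.Nullary.Decidable using (Dec; does; _×-dec_; ¬?)

-- ℤₙ is represented by Fin n, with toℕ giving the representative in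
-- {0, …, n-1}.

infixl 7 _*ₙ_

_*ₙ_ : ∀ {n} → Fin n → Fin n → Fin n
_*ₙ_ {n} x y = (toℕ x * toℕ y) mod n
  where instance _ = nonZeroIndex x

-- Zero itself is not counted as a zero divisor.
ZeroDivisor : ∀ {n} → Fin n → Set
ZeroDivisor {n} x = toℕ x ≢ 0 × (∃[ y ] (toℕ y ≢ 0 × toℕ (x *ₙ y) ≡ 0))

zeroDivisor? : ∀ {n} (x : Fin n) → Dec (ZeroDivisor x)
zeroDivisor? x =
  ¬? (toℕ x ≟ 0) ×-dec any? (λ y → ¬? (toℕ y ≟ 0) ×-dec (toℕ (x *ₙ y) ≟ 0))

Z : ∀ n → Subset n
Z n = tabulate (λ x → does (zeroDivisor? x))

-- An unordered pair {a , b}, with a = b allowed, is represented by the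
-- unique ordered pair of its members with a ≤ b.
unorderedPairs : ∀ n → List (Fin n × Fin n)
unorderedPairs n =
  filter (λ (a , b) → a ≤ᶠ? b) (cartesianProduct (allFin n) (allFin n))

IsGcdPair : ∀ {n} → Fin n × Fin n → Set
IsGcdPair {n} (a , b) = gcd (toℕ a) (toℕ b) ∣ n

isGcdPair? : ∀ {n} (ab : Fin n × Fin n) → Dec (IsGcdPair ab)
isGcdPair? {n} (a , b) = gcd (toℕ a) (toℕ b) ∣? n

-- The finite sets νₙ and νₙ,A are given as duplicate-free lists, so that
-- their cardinality is the length.
ν : ∀ n → List (Fin n × Fin n)
ν n = filter isGcdPair? (unorderedPairs n)

νIn : ∀ n → Subset n → List (Fin n × Fin n)
νIn n A = filter (λ (a , b) → (a ∈? A) ×-dec (b ∈? A)) (ν n)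

{-# OPTIONS --safe #-}
module Submission where

-- Zero divisors of ℤ_{pʲ⁺¹} are the nonzero multiples of p, and multiplication
-- by p turns the condition gcd(a, b) ∣ pʲ into gcd(pa, pb) ∣ pʲ⁺¹.  Hence
-- (a, b) ↦ (pa, pb) is a bijection from the gcd-pairs of ℤ_{pʲ} with a ≠ 0 onto
-- the gcd-pairs of zero divisors of ℤ_{pʲ⁺¹}.  The remaining gcd-pairs of ℤ_{pʲ}
-- are {0, pⁱ} with i < j, which accounts for the correction term j.

open import Defs
open import Data.Nat.Base using (ℕ; _^_; _∸_; _≤_)
open import Data.Nat.Primality using (Prime)
open import Data.Integer.Base using (+_; _+_; _-_)
open import Data.List.Base using (length)
open import Data.Product.Base using (_×_)
open import Relation.Binary.PropositionalEquality.Core using (_≡_)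

open import Data.Bool.Base using (true)
open import Data.Fin.Base using (Fin; toℕ; fromℕ<)
open import Data.Fin.Properties
  using (toℕ-fromℕ<; toℕ-injective; toℕ<n; nonZeroIndex) renaming (_≤?_ to _≤ᶠ?_)
open import Data.Fin.Subset using () renaming (_∈_ to _∈ˢ_)
open import Data.Fin.Subset.Properties using (_∈?_)
open import Data.Integer.Base using (_⊖_)
import Data.Integer.Properties as ℤ
open import Data.List.Base using (List; _++_; allFin; cartesianProduct; map; upTo)
open import Data.List.Membership.Propositional using (_∈_)
open import Data.List.Membership.Propositional.Properties
  using (∈-map⁺; ∈-map⁻; ∈-filter⁺; ∈-filter⁻; ∈-cartesianProduct⁺; ∈-allFin;
         ∈-upTo⁺; ∈-upTo⁻; ∈-++⁺ˡ; ∈-++⁺ʳ; ∈-++⁻)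
open import Data.List.Membership.Propositional.Properties.WithK using (unique∧set⇒bag)
open import Data.List.Properties using (length-map; length-++; length-upTo)
open import Data.List.Relation.Binary.BagAndSetEquality using (∼bag⇒↭)
open import Data.List.Relation.Binary.Permutation.Propositional.Properties using (↭-length)
open import Data.List.Relation.Unary.Unique.Propositional using (Unique)
import Data.List.Relation.Unary.Unique.Propositional.Properties as Unique
import Data.Nat.Base as ℕ
open import Data.Nat.Base using (zero; suc; _<_; _*_; NonZero; s≤s; z≤n)
open import Data.Nat.Divisibility
open import Data.Nat.DivMod using (_%_; m%n<n)
open import Data.Nat.GCD using (gcd; c*gcd[m,n]≡gcd[cm,cn]; gcd-identityˡ)
open import Data.Nat.Primality using (euclidsLemma; prime⇒nonZero; prime⇒nonTrivial)
open import Data.Nat.Properties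
open import Data.Product.Base using (_,_; proj₂; ∃-syntax)
open import Data.Product.Properties using (,-injectiveˡ; ,-injectiveʳ)
open import Data.Sum.Base using (inj₁; inj₂)
open import Data.Vec.Properties using (lookup∘tabulate; []=⇒lookup; lookup⇒[]=)
open import Function.Base using (_∘_)
open import Function.Bundles using (mk⇔; _⇔_; Equivalence)
open import Function.Construct.Composition using (_⇔-∘_)
open import Relation.Binary.PropositionalEquality
  using (_≢_; refl; sym; trans; cong; cong₂; subst; module ≡-Reasoning)
open import Relation.Binary.Definitions using (tri<; tri≈; tri>)
open import Relation.Nullary using (¬_; yes; no; contradiction)
open import Relation.Nullary.Decidable using (proof; dec-true; _×-dec_)
open import Relation.Nullary.Reflects using (Reflects; invert)

open Equivalence using (to; from)

-- Gcd-pairs and zero divisors as conditions on natural numbers.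

-- Pairs over `Fin (p ^ j)` and over `Fin (p ^ suc j)` have different types; sending both to `ℕ × ℕ`
-- lets the two lists be compared.
values : ∀ {n} → Fin n × Fin n → ℕ × ℕ
values (a , b) = toℕ a , toℕ b

values-injective : ∀ {n} {u v : Fin n × Fin n} → values u ≡ values v → u ≡ v
values-injective eq =
  cong₂ _,_ (toℕ-injective (,-injectiveˡ eq)) (toℕ-injective (,-injectiveʳ eq))

values-surjective : ∀ {n x y} → x < n → y < n → ∃[ ab ] values {n} ab ≡ (x , y)
values-surjective x<n y<n =
  (fromℕ< x<n , fromℕ< y<n) , cong₂ _,_ (toℕ-fromℕ< x<n) (toℕ-fromℕ< y<n)

ν-unique : ∀ n → Unique (ν n)
ν-unique n =
  Unique.filter⁺ isGcdPair?
    (Unique.filter⁺ (λ (a , b) → a ≤ᶠ? b)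
      (Unique.cartesianProduct⁺ (Unique.allFin⁺ n) (Unique.allFin⁺ n)))

νIn-unique : ∀ n A → Unique (νIn n A)
νIn-unique n A = Unique.filter⁺ (λ (a , b) → (a ∈? A) ×-dec (b ∈? A)) (ν-unique n)

∈-ν : ∀ {n} (a b : Fin n) →
  (a , b) ∈ ν n ⇔ (toℕ a ≤ toℕ b × gcd (toℕ a) (toℕ b) ∣ n)
∈-ν {n} a b = mk⇔
  (λ ab∈ν → let ab∈pairs , g = ∈-filter⁻ isGcdPair? {xs = unorderedPairs n} ab∈ν in
    proj₂ (∈-filter⁻ (λ (a , b) → a ≤ᶠ? b) {xs = cartesianProduct (allFin n) (allFin n)} ab∈pairs)
    , g)
  (λ (a≤b , g) →
    ∈-filter⁺ isGcdPair?
      (∈-filter⁺ (λ (a , b) → a ≤ᶠ? b) (∈-cartesianProduct⁺ (∈-allFin a) (∈-allFin b)) a≤b)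
      g)

∈-values-ν : ∀ n {x y} → (x , y) ∈ map values (ν n) ⇔ (x ≤ y × y < n × gcd x y ∣ n)
∈-values-ν n = mk⇔ only-if if
  where
  only-if : ∀ {x y} → (x , y) ∈ map values (ν n) → x ≤ y × y < n × gcd x y ∣ n
  only-if xy∈ with (a , b) , ab∈ , refl ← ∈-map⁻ values xy∈ =
    let a≤b , g = to (∈-ν a b) ab∈ in a≤b , toℕ<n b , g

  if : ∀ {x y} → x ≤ y × y < n × gcd x y ∣ n → (x , y) ∈ map values (ν n)
  if (x≤y , y<n , g)
    with (a , b) , refl ← values-surjective {n} (≤-<-trans x≤y y<n) y<n
    = ∈-map⁺ values (from (∈-ν a b) (x≤y , g))

∈-νIn : ∀ {n} A (a b : Fin n) → (a , b) ∈ νIn n A ⇔ ((a , b) ∈ ν n × a ∈ˢ A × b ∈ˢ A)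
∈-νIn {n} A a b = mk⇔
  (∈-filter⁻ (λ (a , b) → (a ∈? A) ×-dec (b ∈? A)) {xs = ν n})
  (λ (ab∈ν , ∈A) → ∈-filter⁺ (λ (a , b) → (a ∈? A) ×-dec (b ∈? A)) ab∈ν ∈A)

∈-Z : ∀ {n} (x : Fin n) → x ∈ˢ Z n ⇔ ZeroDivisor x
∈-Z {n} x = mk⇔
  (λ x∈Z → invert (subst (Reflects _) (trans (sym lookup-Z) ([]=⇒lookup x∈Z))
                         (proof (zeroDivisor? x))))
  (λ zd → lookup⇒[]= x (Z n) (trans lookup-Z (dec-true (zeroDivisor? x) zd)))
  where lookup-Z = lookup∘tabulate _ x

*ₙ≡0⇔∣ : ∀ {n} (x y : Fin n) → toℕ (x *ₙ y) ≡ 0 ⇔ n ∣ toℕ x * toℕ y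
*ₙ≡0⇔∣ {n} x y = mk⇔
  (λ eq → m%n≡0⇒n∣m _ n (trans (sym toℕ-*ₙ) eq))
  (λ n∣xy → trans toℕ-*ₙ (n∣m⇒m%n≡0 _ n n∣xy))
  where
  instance _ = nonZeroIndex x
  toℕ-*ₙ : toℕ (x *ₙ y) ≡ (toℕ x * toℕ y) % n
  toℕ-*ₙ = toℕ-fromℕ< (m%n<n (toℕ x * toℕ y) n)

-- In a duplicate-free list every element has multiplicity one, so equality as sets is equality as
-- bags, and bag-equal lists are permutations of each other.
unique∧set⇒length≡ : ∀ {A : Set} {xs ys : List A} → Unique xs → Unique ys →
  (∀ {z} → z ∈ xs ⇔ z ∈ ys) → length xs ≡ length ys
unique∧set⇒length≡ xs! ys! eq = ↭-length (∼bag⇒↭ (unique∧set⇒bag xs! ys! eq))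

-- Divisors of prime powers and zero divisors modulo them.

module _ {p : ℕ} (pp : Prime p) where

  private
    instance
      p≢0 : NonZero p
      p≢0 = prime⇒nonZero pp

    1<p : 1 < p
    1<p = ℕ.nonTrivial⇒n>1 p {{prime⇒nonTrivial pp}}

  -- Induction on `j`: in `p ^ suc j ≡ q * d` the prime divides the cofactor `q` or the divisor `d`,
  -- and one factor `p` is cancelled from whichever it is.
  ∣p^⇒≡p^ : ∀ j {d} → d ∣ p ^ j → ∃[ i ] (i ≤ j × d ≡ p ^ i)
  ∣p^⇒≡p^ zero d∣1 = 0 , z≤n , ∣1⇒≡1 d∣1
  ∣p^⇒≡p^ (suc j) {d} (divides q eq)
    with euclidsLemma q d pp (subst (p ∣_) eq (m∣m*n (p ^ j)))
  ... | inj₁ (divides-refl r) =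
    let i , i≤j , d≡ = ∣p^⇒≡p^ j (divides r (*-cancelˡ-≡ (p ^ j) (r * d) p
          (trans eq (trans (cong (_* d) (*-comm r p)) (*-assoc p r d)))))
    in i , m≤n⇒m≤1+n i≤j , d≡
  ... | inj₂ (divides-refl r) =
    let i , i≤j , r≡ = ∣p^⇒≡p^ j (*-cancelˡ-∣ p
          (subst (_∣ p ^ suc j) (*-comm r p) (divides q eq)))
    in suc i , s≤s i≤j , trans (*-comm r p) (cong (p *_) r≡)

  -- Induction on `i`: once `y` is `q * p ^ i`, cancelling `p ^ i` leaves `p ∣ x * q`, and Euclid's
  -- lemma puts the last factor `p` into `q`.
  ∤∧p^∣*⇒p^∣ : ∀ i {x y} → p ∤ x → p ^ i ∣ x * y → p ^ i ∣ y
  ∤∧p^∣*⇒p^∣ zero {y = y} _ _ = 1∣ y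
  ∤∧p^∣*⇒p^∣ (suc i) {x} p∤x p^∣xy
    with ∤∧p^∣*⇒p^∣ i p∤x (∣-trans (n∣m*n p) p^∣xy)
  ... | divides-refl q
    with euclidsLemma x q pp
           (*-cancelʳ-∣ (p ^ i) {{m^n≢0 p i}} (subst (p ^ suc i ∣_) (sym (*-assoc x q (p ^ i))) p^∣xy))
  ... | inj₁ p∣x = contradiction p∣x p∤x
  ... | inj₂ p∣q = *-monoˡ-∣ (p ^ i) p∣q

  -- If `p ∤ x`, then `x * y` vanishes only when the full power `p ^ suc j` divides `y`, which is
  -- impossible for a nonzero `y` below it. Conversely `p ^ j` annihilates every multiple of `p`.
  zeroDivisor⇔∣ : ∀ j (x : Fin (p ^ suc j)) → ZeroDivisor x ⇔ (toℕ x ≢ 0 × p ∣ toℕ x)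
  zeroDivisor⇔∣ j x = mk⇔ only-if if
    where
    only-if : ZeroDivisor x → toℕ x ≢ 0 × p ∣ toℕ x
    only-if (x≢0 , y , y≢0 , xy≡0) with p ∣? toℕ x
    ... | yes p∣x = x≢0 , p∣x
    ... | no  p∤x = contradiction
      (∤∧p^∣*⇒p^∣ (suc j) p∤x (to (*ₙ≡0⇔∣ x y) xy≡0))
      (>⇒∤ {{ℕ.≢-nonZero y≢0}} (toℕ<n y))

    if : toℕ x ≢ 0 × p ∣ toℕ x → ZeroDivisor x
    if (x≢0 , p∣x) = x≢0 , y , y≢0 , from (*ₙ≡0⇔∣ x y) p^∣xy
      where
      p^j<p^1+j : p ^ j < p ^ suc j
      p^j<p^1+j = ^-monoʳ-< p 1<p (n<1+n j)
      -- The annihilator is `p ^ j`: nonzero, and a legitimate residue because it lies below the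
      -- modulus.
      y = fromℕ< p^j<p^1+j
      y≡p^j : toℕ y ≡ p ^ j
      y≡p^j = toℕ-fromℕ< p^j<p^1+j
      y≢0 : toℕ y ≢ 0
      y≢0 y≡0 = ℕ.≢-nonZero⁻¹ (p ^ j) {{m^n≢0 p j}} (trans (sym y≡p^j) y≡0)
      p^∣xy : p ^ suc j ∣ toℕ x * toℕ y
      p^∣xy = subst (λ z → p ^ suc j ∣ toℕ x * z) (sym y≡p^j) (*-monoˡ-∣ (p ^ j) p∣x)

  -- Multiplication by p as a bijection.

  scale : ℕ × ℕ → ℕ × ℕ
  scale (a , b) = p * a , p * b

  scale-injective : ∀ {u v} → scale u ≡ scale v → u ≡ v
  scale-injective eq =
    cong₂ _,_ (*-cancelˡ-≡ _ _ p (,-injectiveˡ eq)) (*-cancelˡ-≡ _ _ p (,-injectiveʳ eq))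

  νZ : ∀ j → List (Fin (p ^ suc j) × Fin (p ^ suc j))
  νZ j = νIn (p ^ suc j) (Z (p ^ suc j))

  ∈-values-νZ : ∀ j {x y} → (x , y) ∈ map values (νZ j) ⇔
    ((x ≤ y × y < p ^ suc j × gcd x y ∣ p ^ suc j) × x ≢ 0 × p ∣ x × p ∣ y)
  ∈-values-νZ j = mk⇔ only-if if
    where
    multiple : ∀ x → x ∈ˢ Z (p ^ suc j) ⇔ (toℕ x ≢ 0 × p ∣ toℕ x)
    multiple x = zeroDivisor⇔∣ j x ⇔-∘ ∈-Z x

    only-if : ∀ {x y} → (x , y) ∈ map values (νZ j) →
      (x ≤ y × y < p ^ suc j × gcd x y ∣ p ^ suc j) × x ≢ 0 × p ∣ x × p ∣ y
    only-if xy∈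
      with (a , b) , ab∈ , refl ← ∈-map⁻ values xy∈
      with ab∈ν , a∈Z , b∈Z ← to (∈-νIn (Z (p ^ suc j)) a b) ab∈
      with a≢0 , p∣a ← to (multiple a) a∈Z | _ , p∣b ← to (multiple b) b∈Z
      = to (∈-values-ν (p ^ suc j)) (∈-map⁺ values ab∈ν) , a≢0 , p∣a , p∣b

    if : ∀ {x y} → (x ≤ y × y < p ^ suc j × gcd x y ∣ p ^ suc j) × x ≢ 0 × p ∣ x × p ∣ y →
      (x , y) ∈ map values (νZ j)
    if (xy∈ν@(x≤y , _) , x≢0 , p∣x , p∣y)
      with (a , b) , ab∈ν , refl ← ∈-map⁻ values (from (∈-values-ν (p ^ suc j)) xy∈ν)
      = ∈-map⁺ values (from (∈-νIn (Z (p ^ suc j)) a b)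
          ( ab∈ν , from (multiple a) (x≢0 , p∣x)
          -- The larger entry `b` is nonzero because it is at least `a`, which is nonzero.
          , from (multiple b) ((λ b≡0 → x≢0 (n≤0⇒n≡0 (subst (toℕ a ≤_) b≡0 x≤y))) , p∣y)))

  scaled : ℕ → List (ℕ × ℕ)
  scaled j = map scale (map values (ν (p ^ j)))

  -- This is the image under `scale` of the gcd-pair {0, p^i}, hence the exponent `suc i`.
  zeroPair : ℕ → ℕ × ℕ
  zeroPair i = 0 , p ^ suc i

  -- The image of `scale` sorted by whether the smaller entry is zero. That this is the image is
  -- shown by the two inclusions `scaled⊆split` and `split⊆scaled`.
  split : ℕ → List (ℕ × ℕ)
  split j = map zeroPair (upTo j) ++ map values (νZ j)

  scaled-unique : ∀ j → Unique (scaled j)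
  scaled-unique j = Unique.map⁺ scale-injective (Unique.map⁺ values-injective (ν-unique (p ^ j)))

  p^-mono-∣ : ∀ {i j} → i ≤ j → p ^ i ∣ p ^ j
  p^-mono-∣ {i} {j} i≤j = subst (λ k → p ^ i ∣ p ^ k) (m+[n∸m]≡n i≤j)
    (subst (p ^ i ∣_) (sym (^-distribˡ-+-* p i (j ∸ i))) (m∣m*n (p ^ (j ∸ i))))

  p^-injective : ∀ {i j} → p ^ i ≡ p ^ j → i ≡ j
  p^-injective {i} {j} eq with <-cmp i j
  ... | tri< i<j _ _ = contradiction eq (<⇒≢ (^-monoʳ-< p 1<p i<j))
  ... | tri≈ _ i≡j _ = i≡j
  ... | tri> _ _ i>j = contradiction (sym eq) (<⇒≢ (^-monoʳ-< p 1<p i>j))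

  split-unique : ∀ j → Unique (split j)
  split-unique j = Unique.++⁺
    (Unique.map⁺ (suc-injective ∘ p^-injective ∘ ,-injectiveʳ) (Unique.upTo⁺ j))
    (Unique.map⁺ values-injective (νIn-unique _ (Z (p ^ suc j))))
    disjoint
    where
    -- The first entry is 0 in one part and nonzero in the other.
    disjoint : ∀ {u} → ¬ (u ∈ map zeroPair (upTo j) × u ∈ map values (νZ j))
    disjoint (u∈₁ , u∈₂)
      with _ , _ , refl ← ∈-map⁻ zeroPair u∈₁
      with _ , 0≢0 , _ ← to (∈-values-νZ j) u∈₂
      = 0≢0 refl

  scaled⊆split : ∀ j {u} → u ∈ scaled j → u ∈ split j
  scaled⊆split j u∈
    with (a , b) , ab∈ , refl ← ∈-map⁻ scale u∈
    with a≤b , b<p^j , g ← to (∈-values-ν (p ^ j)) ab∈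
    with a ≟ 0
  -- Here gcd(pa, pb) = p gcd(a, b), so the gcd condition gains exactly the factor by which the
  -- modulus grows.
  ... | no a≢0 = ∈-++⁺ʳ (map zeroPair (upTo j)) (from (∈-values-νZ j)
    ((*-monoʳ-≤ p a≤b , *-monoʳ-< p b<p^j
      , subst (_∣ p ^ suc j) (c*gcd[m,n]≡gcd[cm,cn] p a b) (*-monoʳ-∣ p g))
    , pa≢0 , m∣m*n a , m∣m*n b))
    where
    pa≢0 : p * a ≢ 0
    pa≢0 pa≡0 = a≢0 (*-cancelˡ-≡ a 0 p (trans pa≡0 (sym (*-zeroʳ p))))
  -- Since gcd(0, b) = b, the second entry is itself a divisor of `p ^ j`, hence a power `p ^ i`.
  -- The bound `b < p ^ j` excludes `i = j`, so exactly the exponents in `upTo j` occur.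
  ... | yes refl
    with i , i≤j , refl ← ∣p^⇒≡p^ j (subst (_∣ p ^ j) (gcd-identityˡ b) g)
    = subst (_∈ split j) (cong (_, p ^ suc i) (sym (*-zeroʳ p)))
        (∈-++⁺ˡ (∈-map⁺ zeroPair (∈-upTo⁺ (≤∧≢⇒< i≤j λ { refl → <-irrefl refl b<p^j }))))

  split⊆scaled : ∀ j {u} → u ∈ split j → u ∈ scaled j
  split⊆scaled j u∈ with ∈-++⁻ (map zeroPair (upTo j)) u∈
  ... | inj₁ u∈₁
    with i , i∈ , refl ← ∈-map⁻ zeroPair u∈₁
    = subst (_∈ scaled j) (cong (_, p ^ suc i) (*-zeroʳ p))
        (∈-map⁺ scale (from (∈-values-ν (p ^ j))
          (z≤n , p^i<p^j , subst (_∣ p ^ j) (sym (gcd-identityˡ (p ^ i)))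
            (p^-mono-∣ (<⇒≤ i<j)))))
    where
    i<j = ∈-upTo⁻ i∈
    p^i<p^j = ^-monoʳ-< p 1<p i<j
  -- Both entries are multiples of `p`; the quotients `c` and `d` form the preimage, and order,
  -- bound and gcd condition each lose one factor `p`.
  ... | inj₂ u∈₂
    with (x≤y , y<p^ , g) , _ , divides c refl , divides d refl ← to (∈-values-νZ j) u∈₂
    = subst (_∈ scaled j) (cong₂ _,_ (*-comm p c) (*-comm p d))
        (∈-map⁺ scale (from (∈-values-ν (p ^ j))
          ( *-cancelʳ-≤ c d p x≤y
          , *-cancelˡ-< p d (p ^ j) (subst (_< p ^ suc j) (*-comm d p) y<p^)
          , *-cancelˡ-∣ p (subst (_∣ p ^ suc j)
              (trans (cong₂ gcd (*-comm c p) (*-comm d p)) (sym (c*gcd[m,n]≡gcd[cm,cn] p c d))) g))))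

  -- Counting.

  length-ν-p^ : ∀ j → length (ν (p ^ j)) ≡ j ℕ.+ length (νZ j)
  length-ν-p^ j = begin
    length (ν (p ^ j))                ≡⟨ length-map values (ν (p ^ j)) ⟨
    length (map values (ν (p ^ j)))   ≡⟨ length-map scale (map values (ν (p ^ j))) ⟨
    length (scaled j)
      -- The bijection enters here, as two duplicate-free lists with the same elements.
      ≡⟨ unique∧set⇒length≡ (scaled-unique j) (split-unique j)
           (mk⇔ (scaled⊆split j) (split⊆scaled j)) ⟩
    length (split j)                  ≡⟨ length-++ (map zeroPair (upTo j)) ⟩
    length (map zeroPair (upTo j)) ℕ.+ length (map values (νZ j))
      ≡⟨ cong₂ ℕ._+_ (trans (length-map zeroPair (upTo j)) (length-upTo j))
           (length-map values (νZ j)) ⟩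
    j ℕ.+ length (νZ j)               ∎
    where open ≡-Reasoning

corollary3p10 : ∀ (p : ℕ) → Prime p →
    (∀ (k : ℕ) → 2 ≤ k →
    + length (νIn (p ^ k) (Z (p ^ k))) ≡ + length (ν (p ^ (k ∸ 1))) - + k + + 1)
    × length (νIn p (Z p)) ≡ 0
corollary3p10 p pp = higher , first
  where
  higher : ∀ k → 2 ≤ k →
    + length (νIn (p ^ k) (Z (p ^ k))) ≡ + length (ν (p ^ (k ∸ 1))) - + k + + 1
  -- With `k = suc j` the exponent `k ∸ 1` reduces to `j`, and the claim becomes (j + n) - (j + 1) +
  -- 1 = n.
  higher (suc j) _ = sym (begin
    + length (ν (p ^ j)) - + suc j + + 1    ≡⟨ cong (λ l → + l - + suc j + + 1) (length-ν-p^ pp j) ⟩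
    -- Subtracting the positive `+ suc j` computes to `_⊖_`, so the remaining steps take place among
    -- natural-number arguments.
    j ℕ.+ n ⊖ suc j + + 1                   ≡⟨ ℤ.distribˡ-⊖-+-pos 1 (j ℕ.+ n) (suc j) ⟩
    j ℕ.+ n ℕ.+ 1 ⊖ suc j                   ≡⟨ cong₂ _⊖_ (+-comm (j ℕ.+ n) 1) (sym (+-identityʳ (suc j))) ⟩
    suc j ℕ.+ n ⊖ (suc j ℕ.+ 0)             ≡⟨ ℤ.+-cancelˡ-⊖ (suc j) n 0 ⟩
    + n                                     ∎)
    where
    open ≡-Reasoning
    n = length (νIn (p ^ suc j) (Z (p ^ suc j)))

  first : length (νIn p (Z p)) ≡ 0
  -- The count at `j = 0`: `ν 1` computes to the empty list, because its only candidate {0, 0} has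
  -- gcd 0, which does not divide 1. The transport is along `p ^ 1 ≡ p`.
  first = subst (λ n → length (νIn n (Z n)) ≡ 0) (^-identityʳ p) (sym (length-ν-p^ pp 0))
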